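{- Let $H$ be a graph with no isolated vertex. If $H$ is bipartite and not a star, then $gr_k^{*}(K_3: H)$ is linear in $k$ (i.e., bounded above and below by linear functions of $k$ with positive leading coefficients depending only on $H$). If $H$ is not bipartite, then $gr_k^{*}(K_3: H)$ is exponential in $k$ (i.e., bounded above and below by functions of the form $c^{k}$ up to constant factors, with constants $c>1$ depending only on $H$).
   Context: A $k$-edge-coloring uses colors from $[k]=\{1,\ldots,k\}$. A subgraph is monochromatic if all its edges have the same color and rainbow if no two of its edges have the same color. The Gallai-Ramsey number $gr_k(K_3: H)$ is the smallest integer $n$ such that every $k$-edge-colored $K_n$ contains either a rainbow $K_3$ or a monochromatic copy of $H$. For $n=gr_k(K_3:H)$ and $0\le s\le n-1$, $K_{n-1}\sqcup K_{1,s}$ denotes the graph obtained from $K_{n-1}$ by adding a new vertex $v$ and $s$ edges joining $v$ to $s$ vertices of $K_{n-1}$. The star-critical Gallai-Ramsey number $gr_k^{*}(K_3: H)$ is the smallest integer $s$ such that every $k$-edge-colored $K_{n-1}\sqcup K_{1,s}$ contains either a rainbow $K_3$ or a monochromatic copy of $H$. -}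

module Defs where

open import Data.Nat using (ℕ; zero; suc; _+_; _*_; _^_; _≤_; _<_)
open import Data.Fin using (Fin; toℕ)
open import Data.Bool using (Bool; true; false)
open import Data.Product using (Σ; ∃; ∃-syntax; _×_; _,_)
open import Data.Sum using (_⊎_)
open import Relation.Nullary using (¬_)
open import Relation.Binary.PropositionalEquality using (_≡_; _≢_)
open import Function.Definitions using (Injective)

record Graph (m : ℕ) : Set where
  field
    adj    : Fin m → Fin m → Bool
    sym    : ∀ u v → adj u v ≡ adj v u
    irrefl : ∀ u → adj u u ≡ false
open Graph public

NoIsolated : ∀ {m} → Graph m → Set
NoIsolated {m} H = ∀ (u : Fin m) → ∃[ v ] adj H u v ≡ true

Bipartite : ∀ {m} → Graph m → Set
Bipartite {m} H = Σ (Fin m → Bool) λ f → (∀ (u v : Fin m) → adj H u v ≡ true → f u ≢ f v)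

IsStar : ∀ {m} → Graph m → Set
IsStar {m} H = ∃[ c ] ((∀ (v : Fin m) → v ≢ c → adj H c v ≡ true)
                     × (∀ (u v : Fin m) → adj H u v ≡ true → (u ≡ c ⊎ v ≡ c)))

HostGraph : ℕ → Set₁
HostGraph n = Fin n → Fin n → Set

Colouring : ℕ → ℕ → Set
Colouring k n = Fin n → Fin n → Fin k

SymColouring : ∀ {k n} → Colouring k n → Set
SymColouring {n = n} col = ∀ (i j : Fin n) → col i j ≡ col j i

RainbowK3 : ∀ {k n} → HostGraph n → Colouring k n → Set
RainbowK3 {n = n} G col =
  Σ (Fin n) λ a → Σ (Fin n) λ b → Σ (Fin n) λ c →
    G a b × G b c × G a c ×
    col a b ≢ col b c × col b c ≢ col a c × col a b ≢ col a c

MonoCopy : ∀ {k n m} → HostGraph n → Colouring k n → Graph m → Set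
MonoCopy {k} {n} {m} G col H =
  Σ (Fin m → Fin n) λ f → Σ (Fin k) λ c →
    Injective _≡_ _≡_ f ×
    (∀ (u v : Fin m) → adj H u v ≡ true → G (f u) (f v) × col (f u) (f v) ≡ c)

Arrows : ∀ {n m} → ℕ → HostGraph n → Graph m → Set
Arrows {n} k G H = ∀ (col : Colouring k n) → SymColouring col →
  RainbowK3 G col ⊎ MonoCopy G col H

Complete : (n : ℕ) → HostGraph n
Complete n i j = i ≢ j

-- K_{N} ⊔ K_{1,s} on vertex set Fin (suc N): vertices with toℕ < N form K_N,
-- the vertex with toℕ ≡ N is v, joined to the vertices with toℕ < s.
StarHost : (N s : ℕ) → HostGraph (suc N)
StarHost N s i j = i ≢ j ×
  ((toℕ i < N × toℕ j < N) ⊎ (toℕ i ≡ N × toℕ j < s) ⊎ (toℕ j ≡ N × toℕ i < s))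

IsGR : ∀ {m} → ℕ → Graph m → ℕ → Set
IsGR k H n = Arrows k (Complete n) H × (∀ n' → Arrows k (Complete n') H → n ≤ n')

-- s = gr*_k(K3 : H), given gr_k(K3 : H) = suc N  (s ranges over 0..N)
IsStarCritGR : ∀ {m} → ℕ → Graph m → ℕ → ℕ → Set
IsStarCritGR k H N s = s ≤ N × Arrows k (StarHost N s) H ×
  (∀ s' → s' ≤ N → Arrows k (StarHost N s') H → s ≤ s')

-- gr*_k(K3:H) is linear in k: for all k ≥ 1,
--   (p/q) k - b/q ≤ gr*_k ≤ a k + b'   with p, q, a ≥ 1
LinearInK : ∀ {m} → Graph m → Set
LinearInK H = Σ ℕ λ p → Σ ℕ λ q → Σ ℕ λ b → Σ ℕ λ a → Σ ℕ λ b' →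
  1 ≤ p × 1 ≤ q × 1 ≤ a ×
  (∀ k → 1 ≤ k → Σ ℕ λ N → Σ ℕ λ s →
     IsGR k H (suc N) × IsStarCritGR k H N s ×
     p * k ≤ q * s + b × s ≤ a * k + b')

-- gr*_k(K3:H) is exponential in k: for all k ≥ 1,
--   (α/β) (p/q)^k ≤ gr*_k ≤ γ c^k   with α, β, q ≥ 1, p > q, c ≥ 2
ExponentialInK : ∀ {m} → Graph m → Set
ExponentialInK H = Σ ℕ λ α → Σ ℕ λ β → Σ ℕ λ p → Σ ℕ λ q → Σ ℕ λ γ → Σ ℕ λ c →
  1 ≤ α × 1 ≤ β × 1 ≤ q × q < p × 1 ≤ γ × 2 ≤ c ×
  (∀ k → 1 ≤ k → Σ ℕ λ N → Σ ℕ λ s →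
     IsGR k H (suc N) × IsStarCritGR k H N s ×
     α * p ^ k ≤ β * (q ^ k * s) × s ≤ γ * c ^ k)

{-# OPTIONS --safe #-}
module Submission where

-- Upper bounds: in a colouring without rainbow triangles every triple of vertices contains a
-- monochromatic cherry, so averaging gives a vertex b such that col x b = col x z for at least a third
-- of all pairs (x , z).  Iterating yields long chains, hence monochromatic cliques in order 4^(km); applied
-- to the many x of large degree in this relation, with a common colour col x b, it yields
-- monochromatic K_{m,m} in order O(k).
--
-- Lower bounds: the same relation gives a large set M and a set S of positive proportion such that every
-- x ∈ S sends a single colour to M.  Adding a new vertex to a critical colouring as a twin of M with respect
-- to S creates neither a rainbow triangle nor a monochromatic H, so gr⋆ is at least a constant fraction of gr,
-- and gr itself is bounded below by the colourings by smaller endpoint and by first differing digit.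

open import Defs hiding (sym)
open import Data.Nat as ℕ using (ℕ; zero; suc; _+_; _*_; _^_; _≤_; _<_; _≤?_; _<?_; z≤n; s≤s; >-nonZero; _⊓_)
open import Data.Nat.Properties hiding (_≟_)
open import Data.Nat.Tactic.RingSolver using (solve-∀)
open import Data.Fin using (Fin; zero; suc; toℕ; fromℕ<; _≟_; inject≤; finToFun; funToFin; combine)
open import Data.Fin.Properties using (any?; all?; toℕ-injective; toℕ<n; toℕ-fromℕ<; fromℕ<-injective; fromℕ<-cong; toℕ-inject≤; funToFin-finToFin; inject≤-injective)
open import Data.Bool as Bool using (Bool; true; false; if_then_else_)
open import Data.Maybe using (Maybe; just; nothing; fromMaybe)
open import Data.Maybe.Properties using (just-injective)
open import Data.List using (List; []; _∷_; _++_; length; map; catMaybes; filter; lookup; allFin)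
open import Data.Nat.ListAction using (sum)
open import Data.List.Properties using (length-map; length-++; length-catMaybes; length-tabulate; filter-all; length-filter)
open import Data.List.Membership.Propositional using (_∈_; _∉_)
open import Data.List.Membership.Propositional.Properties
open import Data.List.Relation.Unary.All as All using (All; []; _∷_)
open import Data.List.Relation.Unary.Any using (here; there)
open import Data.List.Relation.Unary.AllPairs as AllPairs using (AllPairs; []; _∷_)
import Data.List.Relation.Unary.AllPairs.Properties as AllPairs
open import Data.List.Relation.Unary.Unique.Propositional using (Unique)
import Data.List.Relation.Unary.Unique.Propositional.Properties as Unique
import Data.Vec.Functional as Vector
open import Data.Product using (∃; _×_; _,_; proj₁; proj₂)
open import Data.Sum as Sum using (_⊎_; inj₁; inj₂; [_,_]′)
open import Data.Empty using (⊥)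
open import Function using (_∘_; id)
open import Function.Definitions using (Injective)
open import Relation.Nullary using (¬_; Dec; yes; no; does; ¬?; contradiction)
open import Relation.Nullary.Decidable using (map′; _×-dec_; _⊎-dec_; _→-dec_; decidable-stable)
open import Relation.Unary using (Decidable)
open import Relation.Binary.PropositionalEquality

private variable
  A B : Set
  P : Set

-- Finite sums and averaging.

∑ : List A → (A → ℕ) → ℕ
∑ xs f = sum (map f xs)

∑-mono : (xs : List A) {f g : A → ℕ} → (∀ {x} → x ∈ xs → f x ≤ g x) → ∑ xs f ≤ ∑ xs g
∑-mono []       le = z≤n
∑-mono (x ∷ xs) le = +-mono-≤ (le (here refl)) (∑-mono xs (le ∘ there))

∑-cong : (xs : List A) {f g : A → ℕ} → (∀ x → f x ≡ g x) → ∑ xs f ≡ ∑ xs g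
∑-cong []       eq = refl
∑-cong (x ∷ xs) eq = cong₂ _+_ (eq x) (∑-cong xs eq)

∑-+ : (xs : List A) (f g : A → ℕ) → ∑ xs (λ x → f x + g x) ≡ ∑ xs f + ∑ xs g
∑-+ []       f g = refl
∑-+ (x ∷ xs) f g = trans (cong (f x + g x +_) (∑-+ xs f g)) (lemma (f x) (g x) _ _)
  where
  lemma : ∀ a b c d → a + b + (c + d) ≡ a + c + (b + d)
  lemma = solve-∀

∑-const : (xs : List A) (c : ℕ) → ∑ xs (λ _ → c) ≡ length xs * c
∑-const []       c = refl
∑-const (x ∷ xs) c = cong (c +_) (∑-const xs c)

∑-*ˡ : (xs : List A) (c : ℕ) (f : A → ℕ) → ∑ xs (λ x → c * f x) ≡ c * ∑ xs f
∑-*ˡ []       c f = sym (*-zeroʳ c)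
∑-*ˡ (x ∷ xs) c f = trans (cong (c * f x +_) (∑-*ˡ xs c f)) (sym (*-distribˡ-+ c (f x) _))

∑-swap : (xs : List A) (ys : List B) (f : A → B → ℕ) →
  ∑ xs (λ x → ∑ ys (f x)) ≡ ∑ ys (λ y → ∑ xs (λ x → f x y))
∑-swap []       ys f = sym (trans (∑-const ys 0) (*-zeroʳ (length ys)))
∑-swap (x ∷ xs) ys f = trans (cong (∑ ys (f x) +_) (∑-swap xs ys f))
  (sym (∑-+ ys (f x) (λ y → ∑ xs (λ z → f z y))))

𝟙 : Dec P → ℕ
𝟙 P? = if does P? then 1 else 0

𝟙≤1 : (P? : Dec P) → 𝟙 P? ≤ 1
𝟙≤1 (yes _) = ≤-refl
𝟙≤1 (no  _) = z≤n

𝟙-yes : (P? : Dec P) → P → 𝟙 P? ≡ 1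
𝟙-yes (yes _) p = refl
𝟙-yes (no ¬p) p = contradiction p ¬p

-- Turns a case distinction into one linear bound, which can then be summed over vertices.
≤-+𝟙 : ∀ {a b c} (P? : Dec P) → (P → a ≤ b + c) → (¬ P → a ≤ b) → a ≤ b + c * 𝟙 P?
≤-+𝟙 {b = b} {c} (yes p) f g = ≤-trans (f p) (≤-reflexive (cong (b +_) (sym (*-identityʳ c))))
≤-+𝟙 {b = b}     (no ¬p) f g = ≤-trans (g ¬p) (m≤m+n b _)

length-filter-∑ : {R : A → Set} (R? : Decidable R) (xs : List A) →
  length (filter R? xs) ≡ ∑ xs (λ x → 𝟙 (R? x))
length-filter-∑ R? []       = refl
length-filter-∑ R? (x ∷ xs) with R? x
... | yes _ = cong suc (length-filter-∑ R? xs)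
... | no  _ = length-filter-∑ R? xs

∑-𝟙≤length : {R : A → Set} (R? : Decidable R) (xs : List A) → ∑ xs (λ x → 𝟙 (R? x)) ≤ length xs
∑-𝟙≤length R? xs = subst (_≤ length xs) (length-filter-∑ R? xs) (length-filter R? xs)

∑≤length*max : (xs : List A) (f : A → ℕ) → 1 ≤ length xs →
  ∃ λ x → x ∈ xs × ∑ xs f ≤ length xs * f x
∑≤length*max (x ∷ [])     f _ = x , here refl , ≤-refl
∑≤length*max (x ∷ y ∷ ys) f _ with ∑≤length*max (y ∷ ys) f (s≤s z≤n)
... | w , w∈ , le with ≤-total (f x) (f w)
...   | inj₁ x≤w = w , there w∈ , +-mono-≤ x≤w le
...   | inj₂ w≤x = x , here refl ,
  +-monoʳ-≤ (f x) (≤-trans le (*-monoʳ-≤ (length (y ∷ ys)) w≤x))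

-- Lists of distinct vertices and the pigeonhole principle.

module _ {n : ℕ} where

  _∖_ : List (Fin n) → Fin n → List (Fin n)
  xs ∖ y = filter (λ x → ¬? (x ≟ y)) xs

  -- Without repetitions at most one entry is removed. It is only an inequality because `y` may be
  -- absent from `xs`.
  ∑-∖ : (xs : List (Fin n)) (y : Fin n) (f : Fin n → ℕ) → Unique xs → ∑ xs f ≤ f y + ∑ (xs ∖ y) f
  ∑-∖ []       y f u = z≤n
  ∑-∖ (x ∷ xs) y f (x∉ ∷ u) with x ≟ y
  ... | yes refl = +-monoʳ-≤ (f x) (≤-reflexive (cong (λ zs → ∑ zs f)
          (sym (filter-all (λ z → ¬? (z ≟ x)) (All.map (_∘ sym) x∉)))))
  ... | no _ = ≤-trans (+-monoʳ-≤ (f x) (∑-∖ xs y f u)) (≤-reflexive (lemma (f x) (f y) _))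
    where
    lemma : ∀ a b c → a + (b + c) ≡ b + (a + c)
    lemma = solve-∀

  length≡∑ : (xs : List (Fin n)) → length xs ≡ ∑ xs (λ _ → 1)
  length≡∑ xs = sym (trans (∑-const xs 1) (*-identityʳ _))

  length-∖ : (xs : List (Fin n)) (y : Fin n) → Unique xs → length xs ≤ suc (length (xs ∖ y))
  length-∖ xs y u = subst₂ _≤_ (sym (length≡∑ xs)) (cong suc (sym (length≡∑ (xs ∖ y)))) (∑-∖ xs y (λ _ → 1) u)

  -- The entries of `L` are deleted one after another, each at the cost of at most one entry of
  -- `xs`.
  avoid : (L xs : List (Fin n)) → Unique xs →
    ∃ λ ys → Unique ys × (∀ {y} → y ∈ ys → y ∈ xs × y ∉ L) × length xs ≤ length L + length ys
  avoid []      xs u = xs , u , (λ y∈ → y∈ , λ ()) , ≤-refl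
  avoid (l ∷ L) xs u with avoid L (xs ∖ l) (Unique.filter⁺ _ u)
  ... | ys , uy , sub , le = ys , uy , sub′ , ≤-trans (length-∖ xs l u) (s≤s le)
    where
    sub′ : ∀ {y} → y ∈ ys → y ∈ xs × y ∉ l ∷ L
    sub′ y∈ with sub y∈
    ... | y∈∖ , y∉L with ∈-filter⁻ (λ x → ¬? (x ≟ l)) {xs = xs} y∈∖
    ...   | y∈xs , y≢l = y∈xs , λ { (here eq) → y≢l eq ; (there y∈L) → y∉L y∈L }

nonempty : {xs : List A} → 1 ≤ length xs → ∃ λ x → x ∈ xs
nonempty {xs = x ∷ _} _ = x , here refl

-- `R` need not be symmetric and the order of the two positions is unknown, hence the disjunction.
AllPairs-lookup : {R : A → A → Set} {xs : List A} → AllPairs R xs →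
  ∀ i j → i ≢ j → R (lookup xs i) (lookup xs j) ⊎ R (lookup xs j) (lookup xs i)
AllPairs-lookup (px ∷ pxs) zero    zero    ne = contradiction refl ne
AllPairs-lookup (px ∷ pxs) zero    (suc j) ne = inj₁ (All.lookup px (∈-lookup j))
AllPairs-lookup (px ∷ pxs) (suc i) zero    ne = inj₂ (All.lookup px (∈-lookup i))
AllPairs-lookup (px ∷ pxs) (suc i) (suc j) ne = AllPairs-lookup pxs i j (ne ∘ cong suc)

lookup-injective : {xs : List A} → Unique xs → ∀ {i j} → lookup xs i ≡ lookup xs j → i ≡ j
lookup-injective u {i} {j} eq with i ≟ j
... | yes i≡j = i≡j
... | no  i≢j with AllPairs-lookup u i j i≢j
...   | inj₁ ne = contradiction eq ne
...   | inj₂ ne = contradiction (sym eq) ne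

-- Summed over all colours, the class sizes count every entry, so a largest class is at least
-- average.
pigeonhole-colour : ∀ {k} → 1 ≤ k → (xs : List A) (c : A → Fin k) →
  ∃ λ e → length xs ≤ k * length (filter (λ x → c x ≟ e) xs)
pigeonhole-colour {k = k} k≥1 xs c
  with ∑≤length*max (allFin k) (λ e → length (filter (λ x → c x ≟ e) xs))
         (subst (1 ≤_) (sym (length-tabulate {n = k} id)) k≥1)
... | e , _ , le = e , (begin
  length xs                                              ≡⟨ trans (sym (*-identityʳ _)) (sym (∑-const xs 1)) ⟩
  ∑ xs (λ _ → 1)                                         ≤⟨ ∑-mono xs (λ {x} _ → some x) ⟩
  ∑ xs (λ x → ∑ (allFin k) (λ e′ → 𝟙 (c x ≟ e′)))        ≡⟨ ∑-swap xs (allFin k) _ ⟩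
  ∑ (allFin k) (λ e′ → ∑ xs (λ x → 𝟙 (c x ≟ e′)))        ≡⟨ ∑-cong (allFin k) (λ e′ → sym (length-filter-∑ (λ x → c x ≟ e′) xs)) ⟩
  ∑ (allFin k) (λ e′ → length (filter (λ x → c x ≟ e′) xs)) ≤⟨ le ⟩
  length (allFin k) * length (filter (λ x → c x ≟ e) xs) ≡⟨ cong (_* length (filter (λ x → c x ≟ e) xs)) (length-tabulate {n = k} id) ⟩
  k * length (filter (λ x → c x ≟ e) xs) ∎)
  where
  open ≤-Reasoning
  term≤∑ : (ys : List B) (f : B → ℕ) {y : B} → y ∈ ys → f y ≤ ∑ ys f
  term≤∑ (y ∷ ys) f (here refl) = m≤m+n (f y) _
  term≤∑ (y ∷ ys) f (there y∈)  = ≤-trans (term≤∑ ys f y∈) (m≤n+m _ (f y))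
  some : ∀ x → 1 ≤ ∑ (allFin k) (λ e′ → 𝟙 (c x ≟ e′))
  some x = ≤-trans (≤-reflexive (sym (𝟙-yes (c x ≟ c x) refl)))
    (term≤∑ (allFin k) (λ e′ → 𝟙 (c x ≟ e′)) (∈-allFin (c x)))

-- Triples without three colours, colour degrees and homogeneous pairs.

MonoTriples : ∀ {k n} → Colouring k n → Set
MonoTriples col = ∀ a b c → col a b ≡ col a c ⊎ col b a ≡ col b c ⊎ col c a ≡ col c b

-- If two of the vertices coincide, one alternative holds by reflexivity; so three distinct colours
-- force three distinct vertices. Sums over triples can thus run over all of them, degenerate ones
-- included.
¬Rainbow⇒MonoTriples : ∀ {k n} (col : Colouring k n) → SymColouring col →
  ¬ RainbowK3 (Complete n) col → MonoTriples col
¬Rainbow⇒MonoTriples col s ¬rb a b c with col a b ≟ col a c | col b a ≟ col b c | col c a ≟ col c b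
... | yes eq | _      | _      = inj₁ eq
... | no _   | yes eq | _      = inj₂ (inj₁ eq)
... | no _   | no _   | yes eq = inj₂ (inj₂ eq)
... | no a≠  | no b≠  | no c≠  = contradiction
  (a , b , c , (λ { refl → c≠ refl }) , (λ { refl → a≠ refl }) , (λ { refl → b≠ refl }) ,
   (λ eq → b≠ (trans (s b a) eq)) , (λ eq → c≠ (trans (s c a) (trans (sym eq) (s b c)))) , a≠) ¬rb

module _ {k n : ℕ} (col : Colouring k n) where

  -- Here `b` serves to select one colour at each `x`. Loops are counted too, with whatever colour
  -- they have, so the sums carry no side conditions.
  deg : List (Fin n) → Fin n → Fin n → ℕ
  deg xs b x = ∑ xs (λ z → 𝟙 (col x b ≟ col x z))

  -- In a chain each vertex is stored with the single colour that it sends to every later vertex.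
  Follows : Fin n × Fin k → Fin n × Fin k → Set
  Follows (u , e) (w , _) = u ≢ w × e ≡ col u w

  -- The invariant n + 12 j ≤ 12 deg leaves every degree at least n/12 after up to j deletions.
  common-neighbours : (N : ℕ) → 1 ≤ N → ∀ b j (ys X : List (Fin n)) → Unique ys → Unique X → 1 ≤ length X →
    length ys ≤ N → (∀ {x} → x ∈ X → N + 12 * j ≤ 12 * deg ys b x) →
    ∃ λ M → ∃ λ X′ → length M ≡ j × Unique M × Unique X′ × (∀ {y} → y ∈ M → y ∈ ys) ×
      (∀ {x} → x ∈ X′ → x ∈ X × (∀ {y} → y ∈ M → col x b ≡ col x y)) ×
      length X ≤ 12 ^ j * length X′
  common-neighbours N N≥1 b zero    ys X uy uX X≥1 ys≤N degs =
    [] , X , refl , [] , uX , (λ ()) , (λ x∈ → x∈ , λ ()) , ≤-reflexive (sym (*-identityˡ _))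
  -- The next member `y` of `M` is the vertex that agrees with `b` at the most sources in `X`.
  common-neighbours N N≥1 b (suc j) ys X uy uX X≥1 ys≤N degs = step (∑≤length*max ys (λ y → ∑ X (λ x → 𝟙 (col x b ≟ col x y))) ys≥1)
    where
    open ≤-Reasoning
    ys≥1 : 1 ≤ length ys
    ys≥1 with nonempty X≥1
    ... | x , x∈ = *-cancelˡ-< 12 0 (length ys) (begin-strict
      0                  <⟨ N≥1 ⟩
      N                  ≤⟨ m≤m+n N _ ⟩
      N + 12 * suc j     ≤⟨ degs x∈ ⟩
      12 * deg ys b x    ≤⟨ *-monoʳ-≤ 12 (∑-𝟙≤length (λ z → col x b ≟ col x z) ys) ⟩
      12 * length ys ∎)
    step : (∃ λ y → y ∈ ys × ∑ ys (λ y → ∑ X (λ x → 𝟙 (col x b ≟ col x y))) ≤ length ys * ∑ X (λ x → 𝟙 (col x b ≟ col x y))) → _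
    step (y , y∈ , le) = result (common-neighbours N N≥1 b j (ys ∖ y) X₁ (Unique.filter⁺ _ uy) (Unique.filter⁺ _ uX) X₁≥1
        (≤-trans (length-filter _ ys) ys≤N) degs₁)
      where
      X₁ = filter (λ x → col x b ≟ col x y) X
      -- Each source agrees with `b` at no fewer than N/12 of at most N vertices, so the best `y`
      -- retains a twelfth of the sources.
      keep : length X ≤ 12 * length X₁
      keep = *-cancelˡ-≤ N {{>-nonZero N≥1}} (begin
        N * length X                         ≡⟨ trans (*-comm N _) (sym (∑-const X N)) ⟩
        ∑ X (λ _ → N)                        ≤⟨ ∑-mono X (λ x∈ → ≤-trans (m≤m+n N _) (degs x∈)) ⟩
        ∑ X (λ x → 12 * deg ys b x)          ≡⟨ ∑-*ˡ X 12 (deg ys b) ⟩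
        12 * ∑ X (deg ys b)                  ≡⟨ cong (12 *_) (∑-swap X ys _) ⟩
        12 * ∑ ys (λ y → ∑ X (λ x → 𝟙 (col x b ≟ col x y))) ≤⟨ *-monoʳ-≤ 12 le ⟩
        12 * (length ys * ∑ X (λ x → 𝟙 (col x b ≟ col x y))) ≡⟨ cong (λ w → 12 * (length ys * w)) (sym (length-filter-∑ (λ x → col x b ≟ col x y) X)) ⟩
        12 * (length ys * length X₁)         ≤⟨ *-monoʳ-≤ 12 (*-monoˡ-≤ (length X₁) ys≤N) ⟩
        12 * (N * length X₁)                 ≡⟨ lemma N _ ⟩
        N * (12 * length X₁) ∎)
        where
        lemma : ∀ a b → 12 * (a * b) ≡ a * (12 * b)
        lemma = solve-∀
      X₁≥1 : 1 ≤ length X₁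
      X₁≥1 = *-cancelˡ-< 12 0 (length X₁) (≤-trans X≥1 keep)
      -- Deleting `y` lowers a degree by at most one, which is the 12 by which the invariant drops.
      degs₁ : ∀ {x} → x ∈ X₁ → N + 12 * j ≤ 12 * deg (ys ∖ y) b x
      degs₁ {x} x∈ = +-cancelˡ-≤ 12 _ _ (begin
        12 + (N + 12 * j)               ≡⟨ lemma N j ⟩
        N + 12 * suc j                  ≤⟨ degs (proj₁ (∈-filter⁻ (λ x → col x b ≟ col x y) {xs = X} x∈)) ⟩
        12 * deg ys b x                 ≤⟨ *-monoʳ-≤ 12 (∑-∖ ys y (λ z → 𝟙 (col x b ≟ col x z)) uy) ⟩
        12 * (𝟙 (col x b ≟ col x y) + deg (ys ∖ y) b x) ≤⟨ *-monoʳ-≤ 12 (+-monoˡ-≤ _ (𝟙≤1 (col x b ≟ col x y))) ⟩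
        12 * (1 + deg (ys ∖ y) b x)     ≡⟨ *-distribˡ-+ 12 1 _ ⟩
        12 + 12 * deg (ys ∖ y) b x ∎)
        where
        lemma : ∀ N j → 12 + (N + 12 * j) ≡ N + 12 * suc j
        lemma = solve-∀
      result : (∃ λ M → ∃ λ X′ → length M ≡ j × Unique M × Unique X′ × (∀ {z} → z ∈ M → z ∈ ys ∖ y) ×
        (∀ {x} → x ∈ X′ → x ∈ X₁ × (∀ {z} → z ∈ M → col x b ≡ col x z)) × length X₁ ≤ 12 ^ j * length X′) → _
      result (M , X′ , len , uM , uX′ , M⊆ , hom , le′) =
        y ∷ M , X′ , cong suc len , All.tabulate (λ z∈ eq → proj₂ (M⊆ys z∈) (sym eq)) ∷ uM , uX′ ,
        (λ { (here refl) → y∈ ; (there z∈) → proj₁ (M⊆ys z∈) }) , (λ {x} → hom′ {x}) , (begin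
          length X                   ≤⟨ keep ⟩
          12 * length X₁             ≤⟨ *-monoʳ-≤ 12 le′ ⟩
          12 * (12 ^ j * length X′)  ≡⟨ sym (*-assoc 12 (12 ^ j) _) ⟩
          12 ^ suc j * length X′ ∎)
        where
        M⊆ys : ∀ {z} → z ∈ M → z ∈ ys × z ≢ y
        M⊆ys z∈ = ∈-filter⁻ (λ x → ¬? (x ≟ y)) {xs = ys} (M⊆ z∈)
        hom′ : ∀ {x} → x ∈ X′ → x ∈ X × (∀ {z} → z ∈ y ∷ M → col x b ≡ col x z)
        hom′ x∈ with hom x∈
        ... | x∈X₁ , eqs with ∈-filter⁻ (λ x → col x b ≟ col x y) {xs = X} x∈X₁
        ...   | x∈X , eq = x∈X , λ { (here refl) → eq ; (there z∈) → eqs z∈ }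

  -- A pair homogeneous from one side: every `x` in `X′` has a single colour towards `M`, but that
  -- colour may vary with `x`.
  Homogeneous : ℕ → Fin n → List (Fin n) → Set
  Homogeneous j b X = ∃ λ M → ∃ λ X′ → length M ≡ j × Unique M × Unique X′ ×
    (∀ {x} → x ∈ X′ → x ∈ X × (∀ {y} → y ∈ M → col x b ≡ col x y)) ×
    length X ≤ 12 ^ j * length X′

  homogeneous : ∀ j b (X : List (Fin n)) → Unique X → 1 ≤ n → 1 ≤ length X → 12 * j ≤ n →
    (∀ {x} → x ∈ X → n ≤ 6 * deg (allFin n) b x) → Homogeneous j b X
  homogeneous j b X uX n≥1 X≥1 j≤ degs
    with common-neighbours n n≥1 b j (allFin n) X (Unique.allFin⁺ n) uX X≥1
           (≤-reflexive (length-tabulate {n = n} id)) degs′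
    where
    open ≤-Reasoning
    degs′ : ∀ {x} → x ∈ X → n + 12 * j ≤ 12 * deg (allFin n) b x
    degs′ {x} x∈ = begin
      -- One half of `12 * deg` covers `n`; the other covers the `12 * j ≤ n` reserved for
      -- deletions.
      n + 12 * j  ≤⟨ +-mono-≤ (degs x∈) (≤-trans j≤ (degs x∈)) ⟩
      6 * deg (allFin n) b x + 6 * deg (allFin n) b x ≡⟨ sym (*-distribʳ-+ (deg (allFin n) b x) 6 6) ⟩
      12 * deg (allFin n) b x ∎
  ... | M , X′ , len , uM , uX′ , _ , hom , le = M , X′ , len , uM , uX′ , hom , le

-- Averaging over monochromatic cherries: chains and dense sources.

module _ {k n : ℕ} (col : Colouring k n) (tri : MonoTriples col) where

  -- Double counting: every triple contributes a monochromatic cherry at one of its three vertices.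
  dense-target : (xs : List (Fin n)) → 1 ≤ length xs →
    ∃ λ b → b ∈ xs × length xs * length xs ≤ 3 * ∑ xs (deg col xs b)
  dense-target xs ne with ∑≤length*max xs (λ b → ∑ xs (deg col xs b)) ne
  ... | b , b∈ , le = b , b∈ , *-cancelˡ-≤ ℓ {{>-nonZero ne}} (begin
    ℓ * (ℓ * ℓ)                     ≡⟨ sym cube ⟩
    ∑³ (λ _ _ _ → 1)                ≤⟨ ∑³-mono one ⟩
    ∑³ (λ x y z → t x y z + (t y x z + t z x y)) ≡⟨ ∑³-+ _ _ ⟩
    ∑³ t + ∑³ (λ x y z → t y x z + t z x y) ≡⟨ cong (∑³ t +_) (∑³-+ _ _) ⟩
    -- Renaming the summation variables moves the apex to the first place, so the three sums agree.
    ∑³ t + (∑³ (λ x y z → t y x z) + ∑³ (λ x y z → t z x y)) ≡⟨ cong (∑³ t +_) (cong₂ _+_ (∑-swap xs xs _) rot) ⟩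
    ∑³ t + (∑³ t + ∑³ t)             ≡⟨ cong (λ w → ∑³ t + (∑³ t + w)) (sym (+-identityʳ _)) ⟩
    -- The endpoint `y` becomes the outermost variable, so that the average is taken over targets
    -- and not over apices.
    3 * ∑³ t                        ≡⟨ cong (3 *_) (∑-swap xs xs _) ⟩
    3 * ∑ xs (λ y → ∑ xs (deg col xs y)) ≤⟨ *-monoʳ-≤ 3 le ⟩
    3 * (ℓ * ∑ xs (deg col xs b))       ≡⟨ lemma ℓ _ ⟩
    ℓ * (3 * ∑ xs (deg col xs b)) ∎)
    where
    open ≤-Reasoning
    ℓ = length xs
    t : Fin n → Fin n → Fin n → ℕ
    t x y z = 𝟙 (col x y ≟ col x z)
    ∑³ : (Fin n → Fin n → Fin n → ℕ) → ℕ
    ∑³ f = ∑ xs (λ x → ∑ xs (λ y → ∑ xs (f x y)))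
    ∑³-mono : ∀ {f g : Fin n → Fin n → Fin n → ℕ} → (∀ x y z → f x y z ≤ g x y z) → ∑³ f ≤ ∑³ g
    ∑³-mono le = ∑-mono xs (λ _ → ∑-mono xs (λ _ → ∑-mono xs (λ _ → le _ _ _)))
    ∑³-+ : ∀ f g → ∑³ (λ x y z → f x y z + g x y z) ≡ ∑³ f + ∑³ g
    ∑³-+ f g = trans (∑-cong xs (λ x → trans (∑-cong xs (λ y → ∑-+ xs (f x y) (g x y)))
      (∑-+ xs (λ y → ∑ xs (f x y)) (λ y → ∑ xs (g x y)))))
      (∑-+ xs (λ x → ∑ xs (λ y → ∑ xs (f x y))) (λ x → ∑ xs (λ y → ∑ xs (g x y))))
    rot : ∑³ (λ x y z → t z x y) ≡ ∑³ t
    rot = trans (∑-cong xs (λ x → ∑-swap xs xs (λ y z → t z x y))) (∑-swap xs xs _)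
    cube : ∑³ (λ _ _ _ → 1) ≡ ℓ * (ℓ * ℓ)
    cube = trans (∑-cong xs (λ _ → trans (∑-cong xs (λ _ → sym (length≡∑ xs))) (∑-const xs ℓ))) (∑-const xs (ℓ * ℓ))
    one : ∀ x y z → 1 ≤ t x y z + (t y x z + t z x y)
    one x y z with tri x y z
    ... | inj₁ eq = ≤-trans (≤-reflexive (sym (𝟙-yes (col x y ≟ col x z) eq))) (m≤m+n _ _)
    ... | inj₂ (inj₁ eq) = ≤-trans (≤-trans (≤-reflexive (sym (𝟙-yes (col y x ≟ col y z) eq))) (m≤m+n _ _)) (m≤n+m _ (t x y z))
    ... | inj₂ (inj₂ eq) = ≤-trans (≤-trans (≤-reflexive (sym (𝟙-yes (col z x ≟ col z y) eq))) (m≤n+m _ (t y x z))) (m≤n+m _ (t x y z))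
    lemma : ∀ a b → 3 * (a * b) ≡ a * (3 * b)
    lemma = solve-∀

  -- A second averaging, now over the apices belonging to the target from `dense-target`, finds one
  -- vertex that sends a single colour to a third of the list.
  large-degree : (xs : List (Fin n)) → 1 ≤ length xs →
    ∃ λ a → ∃ λ e → a ∈ xs × length xs ≤ 3 * length (filter (λ z → e ≟ col a z) xs)
  large-degree xs ne with dense-target xs ne
  ... | b , _ , le₁ with ∑≤length*max xs (deg col xs b) ne
  ...   | a , a∈ , le₂ = a , col a b , a∈ , subst (λ w → ℓ ≤ 3 * w)
    (sym (length-filter-∑ (λ z → col a b ≟ col a z) xs))
    (*-cancelˡ-≤ ℓ {{>-nonZero ne}} (begin
      ℓ * ℓ                     ≤⟨ le₁ ⟩
      3 * ∑ xs (deg col xs b)       ≤⟨ *-monoʳ-≤ 3 le₂ ⟩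
      3 * (ℓ * deg col xs b a)      ≡⟨ lemma ℓ _ ⟩
      ℓ * (3 * deg col xs b a) ∎))
    where
    open ≤-Reasoning
    ℓ = length xs
    lemma : ∀ a b → 3 * (a * b) ≡ a * (3 * b)
    lemma = solve-∀

  -- Keep the third of the list that `a` meets in one colour, remove `a` itself, and recurse. Base 4
  -- instead of 3 pays for the removal.
  chain : ∀ L (xs : List (Fin n)) → Unique xs → 4 ^ L ≤ length xs →
    ∃ λ ps → length ps ≡ L × All (λ p → proj₁ p ∈ xs) ps × AllPairs (Follows col) ps
  chain zero    xs u le = [] , refl , [] , []
  chain (suc L) xs u le = step (large-degree xs (≤-trans (m^n>0 4 (suc L)) le))
    where
    step : (∃ λ a → ∃ λ e → a ∈ xs × length xs ≤ 3 * length (filter (λ z → e ≟ col a z) xs)) →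
      ∃ λ ps → length ps ≡ suc L × All (λ p → proj₁ p ∈ xs) ps × AllPairs (Follows col) ps
    step (a , e , a∈ , big) = result (chain L rest (Unique.filter⁺ _ uniq-nbrs) enough)
      where
      open ≤-Reasoning
      nbrs = filter (λ z → e ≟ col a z) xs
      uniq-nbrs : Unique nbrs
      uniq-nbrs = Unique.filter⁺ _ u
      rest = nbrs ∖ a
      enough : 4 ^ L ≤ length rest
      enough = ≮⇒≥ λ lt → <-irrefl refl (begin-strict
        3 * length nbrs          ≤⟨ *-monoʳ-≤ 3 (≤-trans (length-∖ nbrs a uniq-nbrs) lt) ⟩
        3 * 4 ^ L                <⟨ *-monoˡ-< (4 ^ L) {{>-nonZero (m^n>0 4 L)}} (n<1+n 3) ⟩
        4 * 4 ^ L                ≤⟨ le ⟩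
        length xs                ≤⟨ big ⟩
        3 * length nbrs ∎)
      split : ∀ {z} → z ∈ rest → z ∈ xs × a ≢ z × e ≡ col a z
      split z∈ with ∈-filter⁻ (λ x → ¬? (x ≟ a)) {xs = nbrs} z∈
      ... | z∈nbrs , z≢a with ∈-filter⁻ (λ z → e ≟ col a z) {xs = xs} z∈nbrs
      ...   | z∈xs , eq = z∈xs , z≢a ∘ sym , eq
      result : (∃ λ ps → length ps ≡ L × All (λ p → proj₁ p ∈ rest) ps × AllPairs (Follows col) ps) →
        ∃ λ ps → length ps ≡ suc L × All (λ p → proj₁ p ∈ xs) ps × AllPairs (Follows col) ps
      result (ps , len , ps∈ , fol) = (a , e) ∷ ps , cong suc len ,
        a∈ ∷ All.map (proj₁ ∘ split) ps∈ , All.map (proj₂ ∘ split) ps∈ ∷ fol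

  -- The degrees towards `b` average at least n/3 and none exceeds n. Those below n/6 contribute at
  -- most half of the guaranteed total, so at least n/6 vertices reach the threshold.
  dense-sources : 1 ≤ n → ∃ λ b → ∃ λ X → Unique X × n ≤ 6 * length X ×
    (∀ {x} → x ∈ X → n ≤ 6 * deg col (allFin n) b x)
  dense-sources n≥1 with dense-target (allFin n) (subst (1 ≤_) (sym (length-tabulate {n = n} id)) n≥1)
  ... | b , _ , le = b , filter heavy? V , Unique.filter⁺ heavy? (Unique.allFin⁺ n) , many ,
    (λ x∈ → proj₂ (∈-filter⁻ heavy? {xs = V} x∈))
    where
    open ≤-Reasoning
    V = allFin n
    len : length V ≡ n
    len = length-tabulate {n = n} id
    heavy? : ∀ x → Dec (n ≤ 6 * deg col V b x)
    heavy? x = n ≤? 6 * deg col V b x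
    bound : ∀ x → 6 * deg col V b x ≤ n + 6 * n * 𝟙 (heavy? x)
    bound x = ≤-+𝟙 (heavy? x) (λ _ → begin
      6 * deg col V b x  ≤⟨ *-monoʳ-≤ 6 (∑-𝟙≤length (λ z → col x b ≟ col x z) V) ⟩
      6 * length V   ≡⟨ cong (6 *_) len ⟩
      6 * n          ≤⟨ m≤n+m _ n ⟩
      n + 6 * n ∎) (λ light → <⇒≤ (≰⇒> light))
    many : n ≤ 6 * length (filter heavy? V)
    many = *-cancelˡ-≤ n {{>-nonZero n≥1}} (+-cancelˡ-≤ (n * n) _ _ (begin
      n * n + n * n                      ≡⟨ lemma₁ (n * n) ⟩
      2 * (n * n)                        ≡⟨ cong (λ w → 2 * (w * w)) (sym len) ⟩
      2 * (length V * length V)          ≤⟨ *-monoʳ-≤ 2 le ⟩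
      2 * (3 * ∑ V (deg col V b))            ≡⟨ sym (*-assoc 2 3 (∑ V (deg col V b))) ⟩
      6 * ∑ V (deg col V b)                  ≡⟨ sym (∑-*ˡ V 6 (deg col V b)) ⟩
      ∑ V (λ x → 6 * deg col V b x)          ≤⟨ ∑-mono V (λ {x} _ → bound x) ⟩
      ∑ V (λ x → n + 6 * n * 𝟙 (heavy? x)) ≡⟨ ∑-+ V _ _ ⟩
      ∑ V (λ _ → n) + ∑ V (λ x → 6 * n * 𝟙 (heavy? x)) ≡⟨ cong₂ _+_ (trans (∑-const V n) (cong (_* n) len)) (∑-*ˡ V (6 * n) _) ⟩
      n * n + 6 * n * ∑ V (λ x → 𝟙 (heavy? x)) ≡⟨ cong (λ w → n * n + 6 * n * w) (sym (length-filter-∑ heavy? V)) ⟩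
      n * n + 6 * n * length (filter heavy? V) ≡⟨ cong (n * n +_) (lemma₂ n _) ⟩
      n * n + n * (6 * length (filter heavy? V)) ∎))
      where
      lemma₁ : ∀ a → a + a ≡ 2 * a
      lemma₁ = solve-∀
      lemma₂ : ∀ a b → 6 * a * b ≡ a * (6 * b)
      lemma₂ = solve-∀

-- Deciding the arrow relation by exhaustive search.

Search : (A : Set) → (A → A → Set) → Set₁
Search A _≈_ = ∀ {P : A → Set} → (∀ {x y} → x ≈ y → P x → P y) → (∀ x → Dec (P x)) → Dec (∃ P)

-- A function is split into its value at `zero` and its tail, which recovers it only pointwise.
-- Without function extensionality the predicate must therefore respect the relation.
search-→ : {_≈_ : A → A → Set} → (∀ {x} → x ≈ x) → Search A _≈_ →
  ∀ n → Search (Fin n → A) (λ f g → ∀ i → f i ≈ g i)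
search-→ ≈-refl search zero resp P? =
  map′ (Vector.[] ,_) (λ { (f , p) → resp {f} {Vector.[]} (λ ()) p }) (P? Vector.[])
search-→ ≈-refl search (suc n) resp P? = map′
  (λ { (a , f , p) → (a Vector.∷ f) , p })
  (λ { (f , p) → f zero , f ∘ suc , resp (λ { zero → ≈-refl ; (suc _) → ≈-refl }) p })
  (search (λ { x≈y (f , p) → f , resp (λ { zero → x≈y ; (suc _) → ≈-refl }) p })
          (λ a → search-→ ≈-refl search n
            (λ eq → resp (λ { zero → ≈-refl ; (suc i) → eq i }))
            (λ f → P? (a Vector.∷ f))))

search-Fin : ∀ {n} → Search (Fin n) _≡_
search-Fin resp P? = any? P?

_≗₂_ : ∀ {k n} → Colouring k n → Colouring k n → Set
col ≗₂ col′ = ∀ i j → col i j ≡ col′ i j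

module _ {k n : ℕ} {G : HostGraph n} (G? : ∀ i j → Dec (G i j)) where

  rainbow? : (col : Colouring k n) → Dec (RainbowK3 G col)
  rainbow? col = any? λ a → any? λ b → any? λ c →
    G? a b ×-dec G? b c ×-dec G? a c ×-dec
    ¬? (col a b ≟ col b c) ×-dec ¬? (col b c ≟ col a c) ×-dec ¬? (col a b ≟ col a c)

  monoCopy? : ∀ {m} (H : Graph m) (col : Colouring k n) → Dec (MonoCopy G col H)
  monoCopy? {m} H col = search-→ refl search-Fin m respects λ f → any? λ c →
    map′ (λ inj {x} {y} → inj x y) (λ inj x y → inj {x} {y})
      (all? λ x → all? λ y → (f x ≟ f y) →-dec (x ≟ y))
    ×-dec (all? λ u → all? λ v → (adj H u v Bool.≟ true) →-dec
      (G? (f u) (f v) ×-dec (col (f u) (f v) ≟ c)))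
    where
    respects : ∀ {f g : Fin m → Fin n} → (∀ i → f i ≡ g i) →
      (∃ λ c → Injective _≡_ _≡_ f × (∀ u v → adj H u v ≡ true → G (f u) (f v) × col (f u) (f v) ≡ c)) →
      (∃ λ c → Injective _≡_ _≡_ g × (∀ u v → adj H u v ≡ true → G (g u) (g v) × col (g u) (g v) ≡ c))
    respects {f} {g} eq (c , inj , mono) = c , (λ {x} {y} e → inj (trans (eq x) (trans e (sym (eq y))))) , mono′
      where
      mono′ : ∀ u v → adj H u v ≡ true → G (g u) (g v) × col (g u) (g v) ≡ c
      mono′ u v uv rewrite sym (eq u) | sym (eq v) = mono u v uv

  -- There are finitely many colourings up to pointwise equality, so a bad one can be searched for.
  -- Decidability is what lets `least` produce the two Ramsey numbers constructively.
  arrows? : ∀ {m} (H : Graph m) → Dec (Arrows k G H)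
  arrows? H = map′
    (λ ¬bad col s → decidable-stable (found? col) (λ ¬found → ¬bad (col , s , ¬found)))
    (λ { arr (col , s , ¬found) → ¬found (arr col s) })
    (¬? (search-→ (λ _ → refl) (search-→ refl search-Fin n) n respects bad?))
    where
    Found : Colouring k n → Set
    Found col = RainbowK3 G col ⊎ MonoCopy G col H
    found? : ∀ col → Dec (Found col)
    found? col = rainbow? col ⊎-dec monoCopy? H col
    Bad : Colouring k n → Set
    Bad col = SymColouring col × ¬ Found col
    bad? : ∀ col → Dec (Bad col)
    bad? col = (all? λ i → all? λ j → col i j ≟ col j i) ×-dec ¬? (found? col)
    found-resp : ∀ {col col′} → col ≗₂ col′ → Found col → Found col′
    found-resp eq (inj₁ (a , b , c , ab , bc , ac , ≢₁ , ≢₂ , ≢₃)) = inj₁ (a , b , c , ab , bc , ac ,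
      subst₂ _≢_ (eq a b) (eq b c) ≢₁ , subst₂ _≢_ (eq b c) (eq a c) ≢₂ , subst₂ _≢_ (eq a b) (eq a c) ≢₃)
    found-resp eq (inj₂ (f , c , inj , mono)) = inj₂ (f , c , inj , λ u v uv →
      proj₁ (mono u v uv) , trans (sym (eq (f u) (f v))) (proj₂ (mono u v uv)))
    respects : ∀ {col col′} → col ≗₂ col′ → Bad col → Bad col′
    respects eq (s , ¬found) = (λ i j → trans (sym (eq i j)) (trans (s i j) (eq j i))) ,
      ¬found ∘ found-resp (λ i j → sym (eq i j))

complete? : ∀ n (i j : Fin n) → Dec (Complete n i j)
complete? n i j = ¬? (i ≟ j)

starHost? : ∀ N s (i j : Fin (suc N)) → Dec (StarHost N s i j)
starHost? N s i j = ¬? (i ≟ j) ×-dec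
  ((toℕ i <? N ×-dec toℕ j <? N) ⊎-dec (toℕ i ℕ.≟ N ×-dec toℕ j <? s) ⊎-dec (toℕ j ℕ.≟ N ×-dec toℕ i <? s))

least : {R : ℕ → Set} → (∀ n → Dec (R n)) → ∀ u → R u →
  ∃ λ n → R n × n ≤ u × (∀ n′ → R n′ → n ≤ n′)
least R? zero    r = zero , r , z≤n , λ _ _ → z≤n
least {R} R? (suc u) r with R? zero
... | yes r₀ = zero , r₀ , z≤n , λ _ _ → z≤n
... | no ¬r₀ with least {R ∘ suc} (R? ∘ suc) u r
...   | n , rn , n≤u , min = suc n , rn , s≤s n≤u , min′
  where
  min′ : ∀ n′ → R n′ → suc n ≤ n′
  min′ zero     r₀ = contradiction r₀ ¬r₀
  min′ (suc n′) r′ = s≤s (min n′ r′)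

-- Upper bounds: monochromatic cliques and bicliques.

embed : ∀ {m} (xs : List A) → .(m ≤ length xs) → Fin m → A
embed xs m≤ i = lookup xs (inject≤ i m≤)

embed-injective : ∀ {m} {xs : List A} .(m≤ : m ≤ length xs) → Unique xs → Injective _≡_ _≡_ (embed xs m≤)
embed-injective m≤ u {x} {y} eq = inject≤-injective m≤ m≤ x y (lookup-injective u eq)

adj⇒≢ : ∀ {m} (H : Graph m) {u v} → adj H u v ≡ true → u ≢ v
adj⇒≢ H {u} uv refl with trans (sym uv) (irrefl H u)
... | ()

-- In a chain, all vertices sharing a colour form a clique of that colour.
arrows-complete-^ : ∀ {m} (H : Graph m) {k} → 1 ≤ k → Arrows k (Complete (4 ^ (k * m))) H
arrows-complete-^ {m} H {k} k≥1 col s with rainbow? (complete? _) col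
... | yes rb = inj₁ rb
... | no ¬rb = inj₂ (copy (chain col (¬Rainbow⇒MonoTriples col s ¬rb) (k * m) (allFin n)
                 (Unique.allFin⁺ n) (≤-reflexive (sym (length-tabulate {n = n} id)))))
  where
  n = 4 ^ (k * m)
  copy : (∃ λ ps → length ps ≡ k * m × All (λ p → proj₁ p ∈ allFin n) ps × AllPairs (Follows col) ps) → MonoCopy (Complete n) col H
  -- Among the `k * m` chain entries some `m` carry the same colour, and any injection of `H` into
  -- them is a copy.
  copy (ps , len , _ , fol) with pigeonhole-colour k≥1 ps proj₂
  ... | e , le = (λ u → proj₁ (at u)) , e , inj , λ u v uv →
      (λ eq → adj⇒≢ H uv (inj eq)) , mono (adj⇒≢ H uv)
    where
    qs = filter (λ p → proj₂ p ≟ e) ps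
    m≤ : m ≤ length qs
    m≤ = *-cancelˡ-≤ k {{>-nonZero k≥1}} (≤-trans (≤-reflexive (sym len)) le)
    at : Fin m → Fin n × Fin k
    at = embed qs m≤
    at-colour : ∀ u → proj₂ (at u) ≡ e
    at-colour u = proj₂ (∈-filter⁻ (λ p → proj₂ p ≟ e) {xs = ps} (∈-lookup (inject≤ u m≤)))
    edge : ∀ {u v} → u ≢ v → Follows col (at u) (at v) ⊎ Follows col (at v) (at u)
    edge u≢v = AllPairs-lookup (AllPairs.filter⁺ (λ p → proj₂ p ≟ e) fol) _ _ (u≢v ∘ inject≤-injective m≤ m≤ _ _)
    mono : ∀ {u v} → u ≢ v → col (proj₁ (at u)) (proj₁ (at v)) ≡ e
    mono {u} {v} u≢v with edge u≢v
    ... | inj₁ (_ , eq) = trans (sym eq) (at-colour u)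
    ... | inj₂ (_ , eq) = trans (s _ _) (trans (sym eq) (at-colour v))
    inj : Injective _≡_ _≡_ (λ u → proj₁ (at u))
    inj {u} {v} eq with u ≟ v
    ... | yes u≡v = u≡v
    ... | no u≢v with edge u≢v
    ...   | inj₁ (ne , _) = contradiction eq ne
    ...   | inj₂ (ne , _) = contradiction (sym eq) ne

-- One side of the bipartition goes into `M`, the other into `ys`. Each list has room for all `m`
-- vertices, so the sizes of the sides need not be known.
biclique-copy : ∀ {m} (H : Graph m) → Bipartite H → ∀ {k n} (col : Colouring k n) → SymColouring col →
  (M ys : List (Fin n)) → Unique M → Unique ys → m ≤ length M → m ≤ length ys → (∀ {x} → x ∈ ys → x ∉ M) →
  ∀ e → (∀ {x y} → x ∈ ys → y ∈ M → col x y ≡ e) → MonoCopy (Complete n) col H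
biclique-copy {m} H (side , proper) {n = n} col s M ys uM uys m≤M m≤ys disjoint e cross =
  f , e , f-inj , λ u v uv → (λ eq → adj⇒≢ H uv (f-inj eq)) , f-mono u v (side u) (side v) (proper u v uv)
  where
  place : Bool → Fin m → Fin n
  place true  = embed M m≤M
  place false = embed ys m≤ys
  f : Fin m → Fin n
  f u = place (side u) u
  in-M : ∀ u → place true u ∈ M
  in-M u = ∈-lookup (inject≤ u m≤M)
  in-ys : ∀ u → place false u ∈ ys
  in-ys u = ∈-lookup (inject≤ u m≤ys)
  place-inj : ∀ p q {u v} → place p u ≡ place q v → u ≡ v
  place-inj true  true  eq = embed-injective m≤M uM eq
  place-inj false false eq = embed-injective m≤ys uys eq
  place-inj true  false {u} {v} eq = contradiction (subst (_∈ M) eq (in-M u)) (disjoint (in-ys v))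
  place-inj false true  {u} {v} eq = contradiction (subst (_∈ M) (sym eq) (in-M v)) (disjoint (in-ys u))
  f-inj : Injective _≡_ _≡_ f
  f-inj {u} {v} = place-inj (side u) (side v)
  f-mono : ∀ u v p q → p ≢ q → col (place p u) (place q v) ≡ e
  f-mono u v true  true  ne = contradiction refl ne
  f-mono u v false false ne = contradiction refl ne
  f-mono u v false true  ne = cross (in-ys u) (in-M v)
  f-mono u v true  false ne = trans (s _ _) (cross (in-ys v) (in-M u))

-- Collects the three losses of `bipartite-copy`: 6 for the dense sources, `k` for fixing a colour,
-- `a` for passing to common neighbours.
cancel-bounds : ∀ {a k n x y z} → 1 ≤ a → 1 ≤ k → 6 * a * z * k ≤ n → n ≤ 6 * (k * y) → y ≤ a * x → z ≤ x
cancel-bounds {a} {k} {n} {x} {y} {z} a≥1 k≥1 ≤n n≤ y≤ = *-cancelˡ-≤ (6 * (a * k)) {{>-nonZero c>0}} (begin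
  6 * (a * k) * z    ≡⟨ lemma₁ a z k ⟩
  6 * a * z * k      ≤⟨ ≤-trans ≤n n≤ ⟩
  6 * (k * y)        ≤⟨ *-monoʳ-≤ 6 (*-monoʳ-≤ k y≤) ⟩
  6 * (k * (a * x))  ≡⟨ lemma₂ a x k ⟩
  6 * (a * k) * x    ∎)
  where
  open ≤-Reasoning
  c>0 : 0 < 6 * (a * k)
  c>0 = *-mono-≤ {1} {6} (s≤s z≤n) (*-mono-≤ a≥1 k≥1)
  lemma₁ : ∀ a z k → 6 * (a * k) * z ≡ 6 * a * z * k
  lemma₁ = solve-∀
  lemma₂ : ∀ a x k → 6 * (k * (a * x)) ≡ 6 * (a * k) * x
  lemma₂ = solve-∀

-- Fixing the colour of `col x b` before applying `homogeneous` makes all edges between `X′` and `M`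
-- the same colour.
bipartite-copy : ∀ {m} (H : Graph m) → 1 ≤ m → Bipartite H → ∀ {k n} → 1 ≤ k → 6 * 12 ^ m * (m + m) * k ≤ n →
  (col : Colouring k n) → SymColouring col → MonoTriples col → MonoCopy (Complete n) col H
bipartite-copy {m} H m≥1 bip {k} {n} k≥1 bound col s tri = choose (dense-sources col tri n≥1)
  where
  open ≤-Reasoning
  12m≤n : 12 * m ≤ n
  12m≤n = begin
    12 * m                        ≡⟨ lemma₁ m ⟩
    6 * 1 * (m + m) * 1           ≤⟨ *-mono-≤ (*-monoˡ-≤ (m + m) (*-monoʳ-≤ 6 (m^n>0 12 m))) k≥1 ⟩
    6 * 12 ^ m * (m + m) * k      ≤⟨ bound ⟩
    n ∎
    where
    lemma₁ : ∀ m → 12 * m ≡ 6 * 1 * (m + m) * 1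
    lemma₁ = solve-∀
  n≥1 : 1 ≤ n
  n≥1 = ≤-trans (≤-trans m≥1 (m≤n*m m 12)) 12m≤n
  choose : (∃ λ b → ∃ λ X → Unique X × n ≤ 6 * length X × (∀ {x} → x ∈ X → n ≤ 6 * deg col (allFin n) b x)) →
    MonoCopy (Complete n) col H
  choose (b , X , uX , n≤ , degs) = use (pigeonhole-colour k≥1 X (λ x → col x b))
    where
    use : (∃ λ e → length X ≤ k * length (filter (λ x → col x b ≟ e) X)) → MonoCopy (Complete n) col H
    use (e , X≤) = build (homogeneous col m b Xₑ (Unique.filter⁺ _ uX) n≥1 Xₑ≥1 12m≤n
        (λ x∈ → degs (proj₁ (in-class x∈))))
      where
      Xₑ = filter (λ x → col x b ≟ e) X
      in-class : ∀ {x} → x ∈ Xₑ → x ∈ X × col x b ≡ e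
      in-class = ∈-filter⁻ (λ x → col x b ≟ e) {xs = X}
      n≤Xₑ : n ≤ 6 * (k * length Xₑ)
      n≤Xₑ = ≤-trans n≤ (*-monoʳ-≤ 6 X≤)
      Xₑ≥1 : 1 ≤ length Xₑ
      Xₑ≥1 = n≢0⇒n>0 λ eq → <-irrefl refl (begin-strict
        0                   <⟨ n≥1 ⟩
        n                   ≤⟨ n≤Xₑ ⟩
        6 * (k * length Xₑ) ≡⟨ cong (λ w → 6 * (k * w)) eq ⟩
        6 * (k * 0)         ≡⟨ cong (6 *_) (*-zeroʳ k) ⟩
        0 ∎)
      build : Homogeneous col m b Xₑ → MonoCopy (Complete n) col H
      -- `X′` may meet `M`; it has at least `m + m` entries, so `m` survive the removal of `M`.
      build (M , X′ , lenM , uM , uX′ , hom , Xₑ≤) with avoid M X′ uX′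
      ... | ys , uys , ys⊆ , X′≤ = biclique-copy H bip col s M ys uM uys (≤-reflexive (sym lenM))
          (+-cancelˡ-≤ m _ _ (≤-trans
            (cancel-bounds {12 ^ m} {k} {n} {length X′} {length Xₑ} {m + m} (m^n>0 12 m) k≥1 bound n≤Xₑ Xₑ≤)
            (subst (λ w → length X′ ≤ w + length ys) lenM X′≤)))
          (proj₂ ∘ ys⊆) e
          (λ x∈ y∈ → trans (sym (proj₂ (hom (proj₁ (ys⊆ x∈))) y∈)) (proj₂ (in-class (proj₁ (hom (proj₁ (ys⊆ x∈)))))))

arrows-complete-* : ∀ {m} (H : Graph m) → 1 ≤ m → Bipartite H → ∀ {k} → 1 ≤ k →
  Arrows k (Complete (6 * 12 ^ m * (m + m) * k)) H
arrows-complete-* H m≥1 bip k≥1 col s with rainbow? (complete? _) col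
... | yes rb = inj₁ rb
... | no ¬rb = inj₂ (bipartite-copy H m≥1 bip k≥1 ≤-refl col s (¬Rainbow⇒MonoTriples col s ¬rb))

-- Extending a colouring by a twin vertex.

∈-catMaybes⁺ : {x : A} {ms : List (Maybe A)} → just x ∈ ms → x ∈ catMaybes ms
∈-catMaybes⁺ (here refl)              = here refl
∈-catMaybes⁺ {ms = just _  ∷ _} (there x∈) = there (∈-catMaybes⁺ x∈)
∈-catMaybes⁺ {ms = nothing ∷ _} (there x∈) = ∈-catMaybes⁺ x∈

lookup-++ˡ-∈ : (xs {ys} : List A) (i : Fin (length (xs ++ ys))) → toℕ i < length xs → lookup (xs ++ ys) i ∈ xs
lookup-++ˡ-∈ (x ∷ xs) zero    lt       = here refl
lookup-++ˡ-∈ (x ∷ xs) (suc i) (s≤s lt) = there (lookup-++ˡ-∈ xs i lt)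

-- A relabelling that lists `S` first, so that the leaves of the star, the vertices numbered below
-- `s`, land in `S`.
enumerate-from : ∀ {n} (S : List (Fin n)) → Unique S →
  ∃ λ (g : Fin n → Fin n) → Injective _≡_ _≡_ g × (∀ i → toℕ i < length S → g i ∈ S)
enumerate-from {n} S uS with avoid S (allFin n) (Unique.allFin⁺ n)
... | rest , uRest , rest∉ , le = embed (S ++ rest) n≤ , embed-injective n≤ uniq ,
    λ i lt → lookup-++ˡ-∈ S (inject≤ i n≤) (subst (_< length S) (sym (toℕ-inject≤ i n≤)) lt)
  where
  n≤ : n ≤ length (S ++ rest)
  n≤ = subst₂ _≤_ (length-tabulate {n = n} id) (sym (length-++ S)) le
  uniq : Unique (S ++ rest)
  uniq = Unique.++⁺ uS uRest (λ { (z∈S , z∈rest) → proj₂ (rest∉ z∈rest) z∈S })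

toℕ≮⇒≡ : ∀ {n} {i : Fin (suc n)} → ¬ toℕ i < n → toℕ i ≡ n
toℕ≮⇒≡ {i = i} i≮n = ≤-antisym (≤-pred (toℕ<n i)) (≮⇒≥ i≮n)

-- The new vertex (nothing) becomes a twin of M with respect to S: a rainbow triangle or
-- monochromatic copy through it avoids some u ∈ M, which can take its place.
module Twin {k n m : ℕ} (col : Colouring k n) (sym-col : SymColouring col) (H : Graph m)
  (M S : List (Fin n)) (uM : Unique M) (|M| : 4 + m ≤ length M) (uS : Unique S)
  (γ : Fin n → Fin k) (hom : ∀ {x y} → x ∈ S → y ∈ M → γ x ≡ col x y) where

  Edge : Maybe (Fin n) → Maybe (Fin n) → Set
  Edge (just a) (just b) = a ≢ b
  Edge (just a) nothing  = a ∈ S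
  Edge nothing  (just b) = b ∈ S
  Edge nothing  nothing  = ⊥

  -- `c₀` is a default for the loop at the new vertex.
  colour : Fin k → Maybe (Fin n) → Maybe (Fin n) → Fin k
  colour c₀ (just a) (just b) = col a b
  colour c₀ (just a) nothing  = γ a
  colour c₀ nothing  (just b) = γ b
  colour c₀ nothing  nothing  = c₀

  colour-sym : ∀ c₀ x y → colour c₀ x y ≡ colour c₀ y x
  colour-sym c₀ (just a) (just b) = sym-col a b
  colour-sym c₀ (just a) nothing  = refl
  colour-sym c₀ nothing  (just b) = refl
  colour-sym c₀ nothing  nothing  = refl

  fresh : (L : List (Maybe (Fin n))) → length L < length M → ∃ λ u → u ∈ M × just u ∉ L
  fresh L lt with avoid (catMaybes L) M uM
  ... | ys , _ , ys⊆ , le with nonempty {xs = ys} (+-cancelˡ-< (length (catMaybes L)) 0 (length ys)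
          (≤-trans (s≤s (≤-trans (≤-reflexive (+-identityʳ _)) (length-catMaybes L))) (≤-trans lt le)))
  ...   | u , u∈ = u , proj₁ (ys⊆ u∈) , proj₂ (ys⊆ u∈) ∘ ∈-catMaybes⁺

  fill : Fin n → Maybe (Fin n) → Fin n
  fill u = fromMaybe u

  -- Replacing the new vertex by `u` can only merge it with `u` itself, which both hypotheses
  -- exclude.
  fill-injective : ∀ {u x y} → just u ≢ x → just u ≢ y → fill u x ≡ fill u y → x ≡ y
  fill-injective {x = just a}  {just b}  ux uy eq = cong just eq
  fill-injective {x = just a}  {nothing} ux uy eq = contradiction (cong just (sym eq)) ux
  fill-injective {x = nothing} {just b}  ux uy eq = contradiction (cong just eq) uy
  fill-injective {x = nothing} {nothing} ux uy eq = refl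

  -- This is the twin property. It is confined to edges, since outside `S` the colour `γ` need not
  -- agree with the colour towards `u`.
  fill-colour : ∀ {c₀ u} x y → u ∈ M → Edge x y → colour c₀ x y ≡ col (fill u x) (fill u y)
  fill-colour (just a) (just b) u∈ ab = refl
  fill-colour (just a) nothing  u∈ a∈ = hom a∈ u∈
  fill-colour nothing  (just b) u∈ b∈ = trans (hom b∈ u∈) (sym-col b _)

  -- The map `h` sends the last vertex to `nothing` and relabels the others by `g`. What the star
  -- host yields is carried back by `fill u`, with `u` chosen outside the triangle or copy.
  arrows-starHost⇒ : ∀ {s} → 1 ≤ k → s ≤ length S → Arrows k (StarHost n s) H →
    RainbowK3 (Complete n) col ⊎ MonoCopy (Complete n) col H
  arrows-starHost⇒ {s} k≥1 s≤ arr with enumerate-from S uS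
  ... | g , g-inj , g∈S = transfer (arr star-col (λ i j → colour-sym c₀ (h i) (h j)))
    where
    c₀ : Fin k
    c₀ = fromℕ< k≥1
    place : (i : Fin (suc n)) → Dec (toℕ i < n) → Maybe (Fin n)
    place i (yes i<n) = just (g (fromℕ< i<n))
    place i (no  _)   = nothing
    h : Fin (suc n) → Maybe (Fin n)
    h i = place i (toℕ i <? n)
    star-col : Colouring k (suc n)
    star-col i j = colour c₀ (h i) (h j)

    place-injective : ∀ {i j} i? j? → place i i? ≡ place j j? → i ≡ j
    place-injective (yes p) (yes q) eq = toℕ-injective (fromℕ<-injective _ _ p q (g-inj (just-injective eq)))
    place-injective (no p)  (no q)  eq = toℕ-injective (trans (toℕ≮⇒≡ p) (sym (toℕ≮⇒≡ q)))
    h-injective : ∀ {i j} → h i ≡ h j → i ≡ j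
    h-injective = place-injective (toℕ _ <? n) (toℕ _ <? n)

    in-S : ∀ {i} (i<n : toℕ i < n) → toℕ i < s → g (fromℕ< i<n) ∈ S
    in-S i<n i<s = g∈S _ (subst (_< length S) (sym (toℕ-fromℕ< i<n)) (<-≤-trans i<s s≤))
    place-edge : ∀ {i j} i? j? → StarHost n s i j → Edge (place i i?) (place j j?)
    place-edge (yes p) (yes q) (i≢j , _) = λ eq → i≢j (toℕ-injective (fromℕ<-injective _ _ p q (g-inj eq)))
    place-edge (yes p) (no q) (_ , inj₁ (_ , j<n))        = contradiction j<n q
    place-edge (yes p) (no q) (_ , inj₂ (inj₁ (i≡n , _))) = contradiction i≡n (<⇒≢ p)
    place-edge (yes p) (no q) (_ , inj₂ (inj₂ (_ , i<s))) = in-S p i<s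
    place-edge (no p) (yes q) (_ , inj₁ (i<n , _))        = contradiction i<n p
    place-edge (no p) (yes q) (_ , inj₂ (inj₁ (_ , j<s))) = in-S q j<s
    place-edge (no p) (yes q) (_ , inj₂ (inj₂ (j≡n , _))) = contradiction j≡n (<⇒≢ q)
    place-edge (no p) (no q) (i≢j , _) = i≢j (toℕ-injective (trans (toℕ≮⇒≡ p) (sym (toℕ≮⇒≡ q))))
    edge : ∀ {i j} → StarHost n s i j → Edge (h i) (h j)
    edge = place-edge (toℕ _ <? n) (toℕ _ <? n)

    transfer : RainbowK3 (StarHost n s) star-col ⊎ MonoCopy (StarHost n s) star-col H →
      RainbowK3 (Complete n) col ⊎ MonoCopy (Complete n) col H
    transfer (inj₁ (a , b , c , ab , bc , ac , ≢₁ , ≢₂ , ≢₃))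
      -- Three vertices are to be avoided, so four members of `M` suffice.
      with fresh (h a ∷ h b ∷ h c ∷ []) (≤-trans (m≤m+n 4 m) |M|)
    ... | u , u∈ , u∉ = inj₁ (r a , r b , r c ,
        apart u≢a u≢b ab , apart u≢b u≢c bc , apart u≢a u≢c ac ,
        subst₂ _≢_ (col-eq ab) (col-eq bc) ≢₁ , subst₂ _≢_ (col-eq bc) (col-eq ac) ≢₂ , subst₂ _≢_ (col-eq ab) (col-eq ac) ≢₃)
      where
      r : Fin (suc n) → Fin n
      r i = fill u (h i)
      col-eq : ∀ {i j} → StarHost n s i j → star-col i j ≡ col (r i) (r j)
      col-eq {i} {j} ij = fill-colour (h i) (h j) u∈ (edge ij)
      apart : ∀ {i j} → just u ≢ h i → just u ≢ h j → StarHost n s i j → r i ≢ r j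
      apart ui uj (i≢j , _) eq = i≢j (h-injective (fill-injective ui uj eq))
      u≢a : just u ≢ h a
      u≢a = u∉ ∘ here
      u≢b : just u ≢ h b
      u≢b = u∉ ∘ there ∘ here
      u≢c : just u ≢ h c
      u≢c = u∉ ∘ there ∘ there ∘ here
    transfer (inj₂ (f , c , f-inj , mono))
      -- Here `m` vertices are to be avoided, so `1 + m` members of `M` suffice.
      with fresh (map (h ∘ f) (allFin m)) (≤-trans (s≤s (≤-trans
             (≤-reflexive (trans (length-map (h ∘ f) (allFin m)) (length-tabulate {n = m} id))) (m≤n+m m 3))) |M|)
    ... | u , u∈ , u∉ = inj₂ ((λ v → fill u (h (f v))) , c , inj , λ v w vw →
        (λ eq → adj⇒≢ H vw (inj eq)) ,
        trans (sym (fill-colour (h (f v)) (h (f w)) u∈ (edge (proj₁ (mono v w vw))))) (proj₂ (mono v w vw)))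
      where
      u≢ : ∀ v → just u ≢ h (f v)
      u≢ v eq = u∉ (subst (_∈ map (h ∘ f) (allFin m)) (sym eq) (∈-map⁺ (h ∘ f) (∈-allFin v)))
      inj : Injective _≡_ _≡_ (λ v → fill u (h (f v)))
      inj {v} {w} eq = f-inj (h-injective (fill-injective (u≢ v) (u≢ w) eq))

-- Comparing the star-critical number with the Ramsey number.

starHost-0-adjacent : ∀ {N} {i j : Fin (suc N)} → StarHost N 0 i j → toℕ i < N × toℕ j < N
starHost-0-adjacent (_ , inj₁ both) = both
starHost-0-adjacent (_ , inj₂ (inj₁ (_ , ())))
starHost-0-adjacent (_ , inj₂ (inj₂ (_ , ())))

-- With no star edges the new vertex is isolated, so neither a triangle nor a copy of a graph
-- without isolated vertices can use it.
arrows-starHost-0 : ∀ {k N m} (H : Graph m) → NoIsolated H →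
  Arrows k (StarHost (suc N) 0) H → Arrows k (Complete (suc N)) H
arrows-starHost-0 {k} {N} {m} H noIso arr col s = transfer (arr star-col (λ i j → s (drop i) (drop j)))
  where
  drop : Fin (suc (suc N)) → Fin (suc N)
  -- Truncation at `N` fixes the old vertices and sends the isolated one to the default `N`.
  drop i = fromℕ< (s≤s (m⊓n≤n (toℕ i) N))
  star-col : Colouring k (suc (suc N))
  star-col i j = col (drop i) (drop j)
  toℕ-drop : ∀ {i} → toℕ i < suc N → toℕ (drop i) ≡ toℕ i
  toℕ-drop {i} (s≤s i≤N) = trans (toℕ-fromℕ< _) (m≤n⇒m⊓n≡m i≤N)
  drop-injective : ∀ {i j} → toℕ i < suc N → toℕ j < suc N → drop i ≡ drop j → i ≡ j
  drop-injective i< j< eq = toℕ-injective (trans (sym (toℕ-drop i<)) (trans (cong toℕ eq) (toℕ-drop j<)))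
  apart : ∀ {i j} → StarHost (suc N) 0 i j → drop i ≢ drop j
  apart ij@(i≢j , _) eq with starHost-0-adjacent {suc N} ij
  ... | i< , j< = i≢j (drop-injective i< j< eq)
  transfer : RainbowK3 (StarHost (suc N) 0) star-col ⊎ MonoCopy (StarHost (suc N) 0) star-col H →
    RainbowK3 (Complete (suc N)) col ⊎ MonoCopy (Complete (suc N)) col H
  transfer (inj₁ (a , b , c , ab , bc , ac , ≢s)) =
    inj₁ (drop a , drop b , drop c , apart ab , apart bc , apart ac , ≢s)
  transfer (inj₂ (f , c , f-inj , mono)) = inj₂ (drop ∘ f , c ,
    (λ {u} {v} eq → f-inj (drop-injective (low u) (low v) eq)) ,
    λ u v uv → apart (proj₁ (mono u v uv)) , proj₂ (mono u v uv))
    where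
    low : ∀ u → toℕ (f u) < suc N
    low u with noIso u
    ... | v , uv = proj₁ (starHost-0-adjacent {suc N} (proj₁ (mono u v uv)))

-- The first summand secures the hypothesis `12 * j ≤ N` of `homogeneous`; the second is the loss
-- from `dense-sources` and `homogeneous` together.
ratio : ℕ → ℕ
ratio j = 12 * j + 6 * 12 ^ j

-- If the bound failed, then in any colouring without a rainbow triangle the homogeneous pair would
-- have at least `s` vertices in `S`. The twin construction would then make `Complete N` arrow `H`.
gr≤ratio*gr⋆ : ∀ {m} (H : Graph m) → NoIsolated H → ∀ {j} → 4 + m ≤ j → ∀ {k} → 1 ≤ k → ∀ {N s} →
  ¬ Arrows k (Complete N) H → Arrows k (StarHost N s) H → N ≤ ratio j * s
gr≤ratio*gr⋆ H noIso j≥ k≥1 {zero} ¬arr arr = z≤n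
-- For `s = 0` the bound would force `N = 0`, so this case has to be refuted.
gr≤ratio*gr⋆ H noIso j≥ k≥1 {suc N} {zero} ¬arr arr = contradiction (arrows-starHost-0 H noIso arr) ¬arr
gr≤ratio*gr⋆ {m} H noIso {j} j≥ {k} k≥1 {N@(suc _)} {s@(suc _)} ¬arr arr with N ≤? ratio j * s
... | yes le = le
... | no ¬le = contradiction (λ col sym-col → good col sym-col (rainbow? (complete? N) col)) ¬arr
  where
  open ≤-Reasoning
  12j≤N : 12 * j ≤ N
  12j≤N = begin
    12 * j                 ≤⟨ m≤m+n _ (6 * 12 ^ j) ⟩
    ratio j                ≤⟨ m≤m*n (ratio j) s ⟩
    ratio j * s            ≤⟨ <⇒≤ (≰⇒> ¬le) ⟩
    N ∎
  good : ∀ col → SymColouring col → Dec (RainbowK3 (Complete N) col) → RainbowK3 (Complete N) col ⊎ MonoCopy (Complete N) col H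
  good col sym-col (yes rb) = inj₁ rb
  good col sym-col (no ¬rb) = choose (dense-sources col (¬Rainbow⇒MonoTriples col sym-col ¬rb) (s≤s z≤n))
    where
    choose : (∃ λ b → ∃ λ X → Unique X × N ≤ 6 * length X × (∀ {x} → x ∈ X → N ≤ 6 * deg col (allFin N) b x)) →
      RainbowK3 (Complete N) col ⊎ MonoCopy (Complete N) col H
    choose (b , X , uX , N≤ , degs) = twin (homogeneous col j b X uX (s≤s z≤n) X≥1 12j≤N degs)
      where
      X≥1 : 1 ≤ length X
      X≥1 = *-cancelˡ-< 6 0 (length X) (<-≤-trans (s≤s z≤n) N≤)
      twin : Homogeneous col j b X → RainbowK3 (Complete N) col ⊎ MonoCopy (Complete N) col H
      twin (M , S , |M| , uM , uS , hom , X≤) = Twin.arrows-starHost⇒ col sym-col H M S uM (≤-trans j≥ (≤-reflexive (sym |M|))) uS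
        (λ x → col x b) (λ x∈ y∈ → proj₂ (hom x∈) y∈) k≥1 s≤S arr
        where
        s≤S : s ≤ length S
        s≤S = ≮⇒≥ λ S<s → ¬le (begin
          N                             ≤⟨ N≤ ⟩
          6 * length X                  ≤⟨ *-monoʳ-≤ 6 X≤ ⟩
          6 * (12 ^ j * length S)       ≡⟨ sym (*-assoc 6 (12 ^ j) (length S)) ⟩
          6 * 12 ^ j * length S         ≤⟨ *-mono-≤ (m≤n+m (6 * 12 ^ j) (12 * j)) (<⇒≤ S<s) ⟩
          ratio j * s ∎)

-- Lower bounds: explicit colourings.

-- Colouring by the smaller endpoint: every colour class is a star.
¬arrows-complete-k : ∀ {m} (H : Graph m) → 1 ≤ m → NoIsolated H → ¬ IsStar H →
  ∀ {k n} → n ≤ k → ¬ Arrows k (Complete n) H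
¬arrows-complete-k {suc _} H _ noIso ¬star {k} {n} n≤k arr =
  [ no-rainbow , no-copy ]′ (arr col (λ i j → fromℕ<-cong _ _ (⊓-comm (toℕ i) (toℕ j)) _ _))
  where
  col : Colouring k n
  col i j = fromℕ< (<-≤-trans (m<n⇒m⊓o<n (toℕ j) (toℕ<n i)) n≤k)
  toℕ-col : ∀ i j → toℕ (col i j) ≡ toℕ i ⊓ toℕ j
  toℕ-col i j = toℕ-fromℕ< _
  same : ∀ i j i′ j′ → toℕ i ⊓ toℕ j ≡ toℕ i′ ⊓ toℕ j′ → col i j ≡ col i′ j′
  same i j i′ j′ eq = toℕ-injective (trans (toℕ-col i j) (trans eq (sym (toℕ-col i′ j′))))
  -- A least vertex of the triangle lies on two of its edges and gives both its colour.
  no-rainbow : ¬ RainbowK3 (Complete n) col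
  no-rainbow (a , b , c , _ , _ , _ , ≢₁ , ≢₂ , ≢₃) with ≤-total (toℕ a) (toℕ b) | ≤-total (toℕ b) (toℕ c) | ≤-total (toℕ a) (toℕ c)
  ... | inj₁ ab | _ | inj₁ ac = ≢₃ (same a b a c (trans (m≤n⇒m⊓n≡m ab) (sym (m≤n⇒m⊓n≡m ac))))
  ... | inj₁ ab | inj₁ bc | inj₂ ca = ≢₃ (same a b a c (trans (m≤n⇒m⊓n≡m ab) (sym (m≤n⇒m⊓n≡m (≤-trans ab bc)))))
  ... | _ | inj₂ cb | inj₂ ca = ≢₂ (same b c a c (trans (m≥n⇒m⊓n≡n cb) (sym (m≥n⇒m⊓n≡n ca))))
  ... | inj₂ ba | inj₁ bc | _ = ≢₁ (same a b b c (trans (m≥n⇒m⊓n≡n ba) (sym (m≤n⇒m⊓n≡m bc))))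
  ... | inj₂ ba | inj₂ cb | inj₁ ac = ≢₂ (same b c a c (trans (m≥n⇒m⊓n≡n cb) (sym (m≥n⇒m⊓n≡n (≤-trans cb ba)))))
  no-copy : ¬ MonoCopy (Complete n) col H
  no-copy (f , c , f-inj , mono) = ¬star (star-at (proj₂ (noIso zero)))
    where
    endpoint : ∀ {u v} → adj H u v ≡ true → toℕ (f u) ≡ toℕ c ⊎ toℕ (f v) ≡ toℕ c
    endpoint {u} {v} uv with ⊓-sel (toℕ (f u)) (toℕ (f v)) | trans (sym (toℕ-col (f u) (f v))) (cong toℕ (proj₂ (mono u v uv)))
    ... | inj₁ eq | ⊓≡c = inj₁ (trans (sym eq) ⊓≡c)
    ... | inj₂ eq | ⊓≡c = inj₂ (trans (sym eq) ⊓≡c)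
    -- Every edge of the copy contains the vertex numbered `c`; since no vertex of `H` is isolated,
    -- each other vertex is joined to this centre.
    star : ∀ a → toℕ (f a) ≡ toℕ c → IsStar H
    star a fa≡c = a , (λ v v≢a → toCentre v v≢a (noIso v)) , cover
      where
      centre : ∀ {u} → toℕ (f u) ≡ toℕ c → u ≡ a
      centre fu≡c = f-inj (toℕ-injective (trans fu≡c (sym fa≡c)))
      cover : ∀ u v → adj H u v ≡ true → u ≡ a ⊎ v ≡ a
      cover u v uv = Sum.map centre centre (endpoint uv)
      toCentre : ∀ v → v ≢ a → (∃ λ w → adj H v w ≡ true) → adj H a v ≡ true
      toCentre v v≢a (w , vw) with cover v w vw
      ... | inj₁ v≡a  = contradiction v≡a v≢a
      ... | inj₂ refl = trans (Graph.sym H w v) vw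
    star-at : ∀ {u v} → adj H u v ≡ true → IsStar H
    star-at uv = [ star _ , star _ ]′ (endpoint uv)

-- The last index is returned without a comparison, as default for equal words. Hence words of
-- length `suc k` need exactly `suc k` colours.
first-difference : ∀ {k} → (Fin (suc k) → Fin 2) → (Fin (suc k) → Fin 2) → Fin (suc k)
first-difference {zero}  x y = zero
first-difference {suc k} x y with x zero ≟ y zero
... | yes _ = suc (first-difference (x ∘ suc) (y ∘ suc))
... | no  _ = zero

first-difference-sym : ∀ {k} (x y : Fin (suc k) → Fin 2) → first-difference x y ≡ first-difference y x
first-difference-sym {zero}  x y = refl
first-difference-sym {suc k} x y with x zero ≟ y zero | y zero ≟ x zero
... | yes _  | yes _  = cong suc (first-difference-sym (x ∘ suc) (y ∘ suc))
... | yes eq | no ne  = contradiction (sym eq) ne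
... | no ne  | yes eq = contradiction (sym eq) ne
... | no _   | no _   = refl

first-difference-≢ : ∀ {k} (x y : Fin (suc k) → Fin 2) → ¬ (∀ i → x i ≡ y i) →
  x (first-difference x y) ≢ y (first-difference x y)
first-difference-≢ {zero}  x y x≢y eq = x≢y λ { zero → eq }
first-difference-≢ {suc k} x y x≢y with x zero ≟ y zero
... | no ne  = ne
... | yes eq = first-difference-≢ (x ∘ suc) (y ∘ suc) (λ eqs → x≢y λ { zero → eq ; (suc i) → eqs i })

-- At the first position where the three words are not all equal, at least two of the pairs differ,
-- and these pairs share their first difference.
first-difference-triangle : ∀ {k} (x y z : Fin (suc k) → Fin 2) →
  ¬ (first-difference x y ≢ first-difference y z × first-difference y z ≢ first-difference x z ×
     first-difference x y ≢ first-difference x z)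
first-difference-triangle {zero}  x y z (≢₁ , _) = ≢₁ refl
first-difference-triangle {suc k} x y z (≢₁ , ≢₂ , ≢₃)
  with x zero ≟ y zero | y zero ≟ z zero | x zero ≟ z zero
... | no _   | no _   | _      = ≢₁ refl
... | _      | no _   | no _   = ≢₂ refl
... | no _   | _      | no _   = ≢₃ refl
... | yes xy | yes yz | no xz  = xz (trans xy yz)
... | yes xy | no yz  | yes xz = yz (trans (sym xy) xz)
... | no xy  | yes yz | yes xz = xy (trans xz (sym yz))
... | yes _  | yes _  | yes _  = first-difference-triangle (x ∘ suc) (y ∘ suc) (z ∘ suc)
  (≢₁ ∘ cong suc , ≢₂ ∘ cong suc , ≢₃ ∘ cong suc)

finToFun-injective : ∀ {m n} (i j : Fin (m ^ n)) → (∀ l → finToFun {m} {n} i l ≡ finToFun j l) → i ≡ j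
finToFun-injective {m} {n} i j eq = trans (sym (funToFin-finToFin {n} {m} i))
  (trans (funToFin-cong eq) (funToFin-finToFin {n} {m} j))
  where
  funToFin-cong : ∀ {m n} {f g : Fin n → Fin m} → (∀ l → f l ≡ g l) → funToFin f ≡ funToFin g
  funToFin-cong {n = zero}  eq = refl
  funToFin-cong {n = suc n} eq = cong₂ combine (eq zero) (funToFin-cong (eq ∘ suc))

-- Colouring by the first differing binary digit: every colour class is bipartite.
¬arrows-complete-2^k : ∀ {m} (H : Graph m) → ¬ Bipartite H →
  ∀ {k n} → 1 ≤ k → n ≤ 2 ^ k → ¬ Arrows k (Complete n) H
¬arrows-complete-2^k {m} H ¬bip {suc k} {n} _ n≤ arr =
  [ no-rainbow , no-copy ]′ (arr col (λ i j → first-difference-sym (bits i) (bits j)))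
  where
  bits : Fin n → Fin (suc k) → Fin 2
  bits i = finToFun {2} {suc k} (inject≤ i n≤)
  col : Colouring (suc k) n
  col i j = first-difference (bits i) (bits j)
  no-rainbow : ¬ RainbowK3 (Complete n) col
  no-rainbow (a , b , c , _ , _ , _ , ≢s) = first-difference-triangle (bits a) (bits b) (bits c) ≢s
  no-copy : ¬ MonoCopy (Complete n) col H
  -- The endpoints of an edge of colour `c` differ in digit `c`, so this digit is a proper
  -- 2-colouring of `H`.
  no-copy (f , c , f-inj , mono) = ¬bip ((λ u → does (bits (f u) c ≟ zero)) , proper)
    where
    does-injective : ∀ (x y : Fin 2) → does (x ≟ zero) ≡ does (y ≟ zero) → x ≡ y
    does-injective zero       zero       eq = refl
    does-injective (suc zero) (suc zero) eq = refl
    proper : ∀ u v → adj H u v ≡ true → does (bits (f u) c ≟ zero) ≢ does (bits (f v) c ≟ zero)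
    proper u v uv eq = subst (λ d → bits (f u) d ≢ bits (f v) d) (proj₂ (mono u v uv))
      (first-difference-≢ (bits (f u)) (bits (f v)) λ eqs →
        proj₁ (mono u v uv) (inject≤-injective n≤ n≤ _ _ (finToFun-injective {2} {suc k} _ _ eqs)))
      (does-injective (bits (f u) c) (bits (f v) c) eq)

-- Transfer of bounds and the two growth rates.

-- Guarantees that `s = N` arrows whenever `Complete (suc N)` does, which starts the search for the
-- least `s`.
complete⇒starHost : ∀ {N} {i j : Fin (suc N)} → Complete (suc N) i j → StarHost N N i j
complete⇒starHost {N} {i} {j} i≢j = i≢j , classify (toℕ i <? N) (toℕ j <? N)
  where
  classify : Dec (toℕ i < N) → Dec (toℕ j < N) → _
  classify (yes p) (yes q) = inj₁ (p , q)
  classify (yes p) (no q)  = inj₂ (inj₂ (toℕ≮⇒≡ q , p))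
  classify (no p)  (yes q) = inj₂ (inj₁ (toℕ≮⇒≡ p , q))
  classify (no p)  (no q)  = contradiction (toℕ-injective (trans (toℕ≮⇒≡ p) (sym (toℕ≮⇒≡ q)))) i≢j

arrows-⊆ : ∀ {k n m} {G G′ : HostGraph n} (H : Graph m) → (∀ {i j} → G i j → G′ i j) → Arrows k G H → Arrows k G′ H
arrows-⊆ H G⊆ arr col s with arr col s
... | inj₁ (a , b , c , ab , bc , ac , ≢s)  = inj₁ (a , b , c , G⊆ ab , G⊆ bc , G⊆ ac , ≢s)
... | inj₂ (f , c , f-inj , mono) = inj₂ (f , c , f-inj , λ u v uv → G⊆ (proj₁ (mono u v uv)) , proj₂ (mono u v uv))

-- The common interface of both growth rates: bounds `L` and `U` for the Ramsey number pass to the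
-- star-critical number, with a loss of a factor `r` below.
IsComparable : ∀ {m} → Graph m → ℕ → Set
IsComparable H r = ∀ {k} → 1 ≤ k → ∀ U L → Arrows k (Complete U) H → (∀ {n} → n ≤ L → ¬ Arrows k (Complete n) H) →
  ∃ λ N → ∃ λ s → IsGR k H (suc N) × IsStarCritGR k H N s × L ≤ r * s × s ≤ U

comparable : ∀ {m} (H : Graph m) → NoIsolated H → ∀ {j} → 4 + m ≤ j → IsComparable H (ratio j)
comparable H noIso j≥ {k} k≥1 U L arrU ¬arrL
  with least (λ n → arrows? (complete? n) H) U arrU
-- The lower bound covers `n = 0`, so the Ramsey number is a successor.
... | zero  , arr₀ , _ , _ = contradiction arr₀ (¬arrL z≤n)
... | suc N , arr , N<U , min
  with least (λ s → arrows? (starHost? N s) H) N (arrows-⊆ H complete⇒starHost arr)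
...   | s , arr⋆ , s≤N , min⋆ = N , s , (arr , min) , (s≤N , arr⋆ , λ s′ _ → min⋆ s′) ,
  -- `L ≤ N` since `suc N` arrows, and `N` itself does not arrow by minimality, so `gr≤ratio*gr⋆`
  -- applies.
  ≤-trans (≮⇒≥ λ N<L → ¬arrL N<L arr) (gr≤ratio*gr⋆ H noIso j≥ k≥1 (λ arrN → <-irrefl refl (min N arrN)) arr⋆) ,
  ≤-trans s≤N (<⇒≤ N<U)

1≤ratio : ∀ j → 1 ≤ ratio j
1≤ratio j = ≤-trans (m^n>0 12 j) (≤-trans (m≤n*m (12 ^ j) 6) (m≤n+m _ (12 * j)))

linear : ∀ {m} (H : Graph m) → 1 ≤ m → NoIsolated H → ∀ {r} → 1 ≤ r → IsComparable H r →
  Bipartite H → ¬ IsStar H → LinearInK H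
-- The bounds are `k / r` below and `a * k` above, without additive constants.
linear {m} H m≥1 noIso {r} r≥1 cmp bip ¬star = 1 , r , 0 , a , 0 , ≤-refl , r≥1 , a≥1 , λ k k≥1 →
    bounds k (cmp k≥1 (a * k) k (arrows-complete-* H m≥1 bip k≥1) (¬arrows-complete-k H m≥1 noIso ¬star))
  where
  a = 6 * 12 ^ m * (m + m)
  a≥1 : 1 ≤ a
  a≥1 = *-mono-≤ (*-mono-≤ {1} {6} (s≤s z≤n) (m^n>0 12 m)) (≤-trans m≥1 (m≤m+n m m))
  bounds : ∀ k → (∃ λ N → ∃ λ s → IsGR k H (suc N) × IsStarCritGR k H N s × k ≤ r * s × s ≤ a * k) →
    ∃ λ N → ∃ λ s → IsGR k H (suc N) × IsStarCritGR k H N s × 1 * k ≤ r * s + 0 × s ≤ a * k + 0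
  bounds k (N , s , gr , gr⋆ , lower , upper) = N , s , gr , gr⋆ ,
    subst₂ _≤_ (sym (*-identityˡ k)) (sym (+-identityʳ (r * s))) lower ,
    subst (s ≤_) (sym (+-identityʳ (a * k))) upper

exponential : ∀ {m} (H : Graph m) → 1 ≤ m → ∀ {r} → 1 ≤ r → IsComparable H r →
  ¬ Bipartite H → ExponentialInK H
-- The bounds are `2 ^ k / r` below and `(4 ^ m) ^ k` above.
exponential {m} H m≥1 {r} r≥1 cmp ¬bip = 1 , r , 2 , 1 , 1 , 4 ^ m , ≤-refl , r≥1 , ≤-refl , ≤-refl , ≤-refl ,
    ≤-trans (s≤s (s≤s z≤n)) (^-monoʳ-≤ 4 m≥1) , λ k k≥1 →
    bounds k (cmp k≥1 (4 ^ (k * m)) (2 ^ k) (arrows-complete-^ H k≥1) (¬arrows-complete-2^k H ¬bip k≥1))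
  where
  bounds : ∀ k → (∃ λ N → ∃ λ s → IsGR k H (suc N) × IsStarCritGR k H N s × 2 ^ k ≤ r * s × s ≤ 4 ^ (k * m)) →
    ∃ λ N → ∃ λ s → IsGR k H (suc N) × IsStarCritGR k H N s × 1 * 2 ^ k ≤ r * (1 ^ k * s) × s ≤ 1 * (4 ^ m) ^ k
  bounds k (N , s , gr , gr⋆ , lower , upper) = N , s , gr , gr⋆ ,
    subst₂ _≤_ (sym (*-identityˡ (2 ^ k)))
      (cong (r *_) (trans (sym (*-identityˡ s)) (cong (_* s) (sym (^-zeroˡ k))))) lower ,
    ≤-trans upper (≤-reflexive (trans (cong (4 ^_) (*-comm k m)) (trans (sym (^-*-assoc 4 m k)) (sym (*-identityˡ _)))))

theorem5p6 : ∀ {m} (H : Graph m) → 1 ≤ m → NoIsolated H →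
    (Bipartite H → ¬ IsStar H → LinearInK H) × (¬ Bipartite H → ExponentialInK H)
theorem5p6 {m} H m≥1 noIso = linear H m≥1 noIso r≥1 cmp , exponential H m≥1 r≥1 cmp
  where
  -- `4 + m` is the least size of `M` that `Twin` admits.
  r≥1 = 1≤ratio (4 + m)
  cmp = λ {k} → comparable H noIso {4 + m} ≤-refl {k}
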